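{- Let $G$ be a cograph. A coloring $\sigma$ of $G$ is recursively minimal if and only if it is an hc-coloring.
   Context: All graphs are finite, simple and undirected. A (proper vertex) coloring of $G=(V,E)$ is a surjective map $\sigma:V\to S$ with $\sigma(x)\neq\sigma(y)$ whenever $xy\in E$; $\chi(G)$ is the chromatic number. A cograph is a graph that is $K_1$, or a disjoint union of cographs, or a join of cographs. Color-minimal cographs are colored graphs $(G,\sigma)$ ($\sigma$ a proper coloring) defined recursively: $(G,\sigma)$ is color-minimal if $|\sigma(V)|=\chi(G)$ and either $G=K_1$, or $G$ is the disjoint union, or the join, of at least two graphs $G_i$ such that each $(G_i,\sigma|_{V(G_i)})$ is a color-minimal cograph. A coloring $\sigma$ of $G$ is recursively minimal if $(G,\sigma)$ is a color-minimal cograph. A cotree $(T,t)$ of a cograph $G$ is a rooted tree $T$ with leaf set $V$ and a labeling $t:V^0(T)\to\{0,1\}$ of its inner vertices such that for every inner vertex $u$, $G(u):=G[L(T(u))]$ (with $L(T(u))$ the leaves descending from $u$) is the disjoint union (if $t(u)=0$) or the join (if $t(u)=1$) of the graphs $G(v)$, $v$ a child of $u$. It is binary if every inner vertex has exactly two children. A coloring $\sigma$ is an hc-coloring with respect to a binary cotree $(T,t)$ if for every inner vertex $u$ with children $v_1,v_2$: if $t(u)=1$ then $\sigma(L(T(v_1)))\cap\sigma(L(T(v_2)))=\emptyset$, and if $t(u)=0$ then one of $\sigma(L(T(v_1)))$, $\sigma(L(T(v_2)))$ contains the other. A coloring of $G$ is an hc-coloring of $G$ if it is an hc-coloring with respect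 to some binary cotree of $G$. -}

module Defs where

open import Data.Fin.Base using (Fin)
open import Data.Fin.Properties using (_≟_; any?)
open import Data.Fin.Subset using (Subset; ⊤; ⁅_⁆; _∈_; _⊆_; _∩_; _∪_; ∣_∣; Empty)
open import Data.Fin.Subset.Properties using (_∈?_)
open import Data.Nat.Base using (ℕ; _+_; _≤_)
open import Data.Product.Base using (∃-syntax; _×_)
open import Data.Sum.Base using (_⊎_)
open import Data.Unit.Base using () renaming (⊤ to Unit)
open import Data.Vec.Base using (tabulate)
open import Data.Vec.Functional using (Vector; []; _∷_)
open import Function.Bundles using (_⇔_)
open import Level using (0ℓ)
open import Relation.Binary.Core using (Rel)
open import Relation.Binary.Definitions using (Decidable; Irreflexive; Symmetric)
open import Relation.Binary.PropositionalEquality.Core using (_≡_; _≢_)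
open import Relation.Nullary.Decidable.Core using (does; _×-dec_)
open import Relation.Nullary.Negation.Core using (¬_)

record Graph (n : ℕ) : Set₁ where
  field
    Adj    : Rel (Fin n) 0ℓ
    adj?   : Decidable Adj
    sym    : Symmetric Adj
    irrefl : Irreflexive _≡_ Adj

open Graph public

-- Induced subgraphs G[W] are handled as pairs of a graph G on Fin n and a
-- W : Subset n; G itself is G[⊤].

-- A coloring of G[W] with color set Fin k.  It is a total function on Fin n
-- whose values outside W are irrelevant.  (So it is the usual notion only for
-- nonempty W; the empty set is never a cograph below.)
record Coloring {n} (G : Graph n) (W : Subset n) (k : ℕ) : Set where
  field
    color      : Fin n → Fin k
    surjective : ∀ c → ∃[ v ] v ∈ W × color v ≡ c
    proper     : ∀ {x y} → x ∈ W → y ∈ W → Adj G x y → color x ≢ color y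

open Coloring public

-- k = χ(G[W])
IsChromaticNumber : ∀ {n} → Graph n → Subset n → ℕ → Set
IsChromaticNumber G W k = Coloring G W k × (∀ j → Coloring G W j → k ≤ j)

-- σ(W)
image : ∀ {n k} → (Fin n → Fin k) → Subset n → Subset k
image σ W = tabulate λ c → does (any? λ v → (v ∈? W) ×-dec (σ v ≟ c))

-- The labels 0 and 1 of a cotree.
data Label : Set where
  union join : Label

AdjacencyAcross : ∀ {n} → Graph n → Label → Fin n → Fin n → Set
AdjacencyAcross G union x y = ¬ Adj G x y
AdjacencyAcross G join  x y = Adj G x y

-- G[W] is the disjoint union, respectively the join, of the G[P i].
record IsComposition {n} (G : Graph n) (t : Label) (W : Subset n)
                     {k} (P : Vector (Subset n) k) : Set where
  field
    cover    : ∀ x → x ∈ W ⇔ (∃[ i ] x ∈ P i)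
    disjoint : ∀ {i j} → i ≢ j → Empty (P i ∩ P j)
    across   : ∀ {i j x y} → i ≢ j → x ∈ P i → y ∈ P j → AdjacencyAcross G t x y

-- G[W] is a cograph.
data IsCograph {n} (G : Graph n) : Subset n → Set where
  single  : ∀ v → IsCograph G ⁅ v ⁆
  compose : ∀ {W} t {k} (P : Vector (Subset n) (2 + k)) →
            IsComposition G t W P →
            (∀ i → IsCograph G (P i)) →
            IsCograph G W

-- (G[W], σ|W) is a color-minimal cograph, for σ a proper coloring.
data IsColorMinimal {n s} (G : Graph n) (σ : Fin n → Fin s) : Subset n → Set where
  single  : ∀ v →
            IsChromaticNumber G ⁅ v ⁆ ∣ image σ ⁅ v ⁆ ∣ →
            IsColorMinimal G σ ⁅ v ⁆
  compose : ∀ {W} t {k} (P : Vector (Subset n) (2 + k)) →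
            IsChromaticNumber G W ∣ image σ W ∣ →
            IsComposition G t W P →
            (∀ i → IsColorMinimal G σ (P i)) →
            IsColorMinimal G σ W

IsRecursivelyMinimal : ∀ {n s} (G : Graph n) → Coloring G ⊤ s → Set
IsRecursivelyMinimal G σ = IsColorMinimal G (color σ) ⊤

-- Rooted binary trees with labeled inner vertices and leaves in Fin n.
data BinaryTree (n : ℕ) : Set where
  leaf : Fin n → BinaryTree n
  node : Label → BinaryTree n → BinaryTree n → BinaryTree n

-- L(T)
leaves : ∀ {n} → BinaryTree n → Subset n
leaves (leaf v)     = ⁅ v ⁆
leaves (node t l r) = leaves l ∪ leaves r

Composes : ∀ {n} → Graph n → BinaryTree n → Set
Composes G (leaf v)       = Unit
Composes G T@(node t l r) =
  IsComposition G t (leaves T) (leaves l ∷ leaves r ∷ []) × Composes G l × Composes G r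

-- The disjointness part of IsComposition makes every vertex of G label exactly
-- one leaf.
IsBinaryCotree : ∀ {n} → Graph n → BinaryTree n → Set
IsBinaryCotree G T = leaves T ≡ ⊤ × Composes G T

HCCondition : ∀ {s} → Label → Subset s → Subset s → Set
HCCondition join  A B = Empty (A ∩ B)
HCCondition union A B = A ⊆ B ⊎ B ⊆ A

IsHCWithRespectTo : ∀ {n s} → (Fin n → Fin s) → BinaryTree n → Set
IsHCWithRespectTo σ (leaf v)     = Unit
IsHCWithRespectTo σ (node t l r) =
  HCCondition t (image σ (leaves l)) (image σ (leaves r)) ×
  IsHCWithRespectTo σ l × IsHCWithRespectTo σ r

IsHC : ∀ {n s} (G : Graph n) → Coloring G ⊤ s → Set
IsHC G σ = ∃[ T ] IsBinaryCotree G T × IsHCWithRespectTo (color σ) T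

{-# OPTIONS --safe #-}

-- Two facts about a proper coloring σ carry the proof.  Across a join the
-- colors of the parts are disjoint, so |σ(W)| is the sum of the |σ(Wᵢ)|; across
-- a disjoint union the chromatic number is the maximum of those of the parts.
-- Hence, going up a cotree, the hc-condition keeps |σ(W)| ≤ |τ(W)| for every
-- proper coloring τ.  Conversely, in a color-minimal disjoint union some part
-- uses all the colors of σ(W): otherwise relabeling the colors of each part
-- separately would give a coloring with fewer colors.  Attaching the remaining
-- parts one by one to such a part yields a binary cotree in which every
-- disjoint union satisfies the hc-condition.
module Submission where

open import Defs
open import Data.Bool.Base using (true)
open import Data.Fin.Base using (Fin; zero; suc; toℕ; punchIn; punchOut)
open import Data.Fin.Properties as Fin
  using (_≟_; any?; toℕ-fromℕ<; toℕ<n; toℕ-injective; punchIn-injective; punchInᵢ≢i;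
         punchIn-punchOut)
open import Data.Fin.Subset
open import Data.Fin.Subset.Properties
open import Data.Nat.Base as ℕ using (ℕ; zero; suc; _+_; _≤_; _<_; z≤n; s≤s; s≤s⁻¹; NonZero; >-nonZero)
open import Data.Nat.DivMod using (_mod_; m<n⇒m%n≡m)
open import Data.Nat.Properties as ℕ
  using (≤-refl; ≤-reflexive; ≤-trans; <-≤-trans; +-suc; +-mono-≤; ≰⇒>; <⇒≱; suc-injective)
open import Data.Product.Base using (∃-syntax; _×_; _,_; proj₁; proj₂)
open import Data.Sum.Base using (_⊎_; inj₁; inj₂; [_,_]′)
open import Data.Unit.Base using (tt)
open import Data.Vec.Base using ([]; _∷_; here; there)
open import Data.Vec.Functional as Vector using (Vector; foldr)
open import Data.Vec.Properties using ([]=⇒lookup; lookup⇒[]=; lookup∘tabulate)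
open import Function.Base using (_∘_)
open import Function.Bundles using (_⇔_; mk⇔; Equivalence)
open import Relation.Binary.PropositionalEquality
  using (_≡_; _≢_; refl; trans; cong; subst; module ≡-Reasoning)
  renaming (sym to ≡-sym)
open import Relation.Nullary using (Dec; yes; no; does; contradiction)
open import Relation.Nullary.Decidable using (dec-true; _×-dec_)

private variable
  n s m : ℕ

-- Cardinalities of subsets

∣p∪q∣≤∣p∣+∣q∣ : (p q : Subset n) → ∣ p ∪ q ∣ ≤ ∣ p ∣ + ∣ q ∣
∣p∪q∣≤∣p∣+∣q∣ []            []            = z≤n
∣p∪q∣≤∣p∣+∣q∣ (outside ∷ p) (outside ∷ q) = ∣p∪q∣≤∣p∣+∣q∣ p q
∣p∪q∣≤∣p∣+∣q∣ (outside ∷ p) (inside ∷ q)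
  rewrite +-suc ∣ p ∣ ∣ q ∣ = s≤s (∣p∪q∣≤∣p∣+∣q∣ p q)
∣p∪q∣≤∣p∣+∣q∣ (inside ∷ p)  (outside ∷ q) = s≤s (∣p∪q∣≤∣p∣+∣q∣ p q)
∣p∪q∣≤∣p∣+∣q∣ (inside ∷ p)  (inside ∷ q)
  rewrite +-suc ∣ p ∣ ∣ q ∣ = s≤s (ℕ.m≤n⇒m≤1+n (∣p∪q∣≤∣p∣+∣q∣ p q))

disjoint⇒∣p∣+∣q∣≤∣p∪q∣ : (p q : Subset n) → Empty (p ∩ q) → ∣ p ∣ + ∣ q ∣ ≤ ∣ p ∪ q ∣
disjoint⇒∣p∣+∣q∣≤∣p∪q∣ []            []            _  = z≤n
disjoint⇒∣p∣+∣q∣≤∣p∪q∣ (outside ∷ p) (outside ∷ q) ∅ =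
  disjoint⇒∣p∣+∣q∣≤∣p∪q∣ p q (drop-∷-Empty ∅)
disjoint⇒∣p∣+∣q∣≤∣p∪q∣ (outside ∷ p) (inside ∷ q)  ∅
  rewrite +-suc ∣ p ∣ ∣ q ∣ = s≤s (disjoint⇒∣p∣+∣q∣≤∣p∪q∣ p q (drop-∷-Empty ∅))
disjoint⇒∣p∣+∣q∣≤∣p∪q∣ (inside ∷ p)  (outside ∷ q) ∅ =
  s≤s (disjoint⇒∣p∣+∣q∣≤∣p∪q∣ p q (drop-∷-Empty ∅))
disjoint⇒∣p∣+∣q∣≤∣p∪q∣ (inside ∷ p)  (inside ∷ q)  ∅ = contradiction (zero , here) ∅

p⊆q∧∣q∣≤∣p∣⇒q⊆p : {p q : Subset n} → p ⊆ q → ∣ q ∣ ≤ ∣ p ∣ → q ⊆ p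
p⊆q∧∣q∣≤∣p∣⇒q⊆p {p = p} p⊆q ∣q∣≤∣p∣ {x} x∈q with x ∈? p
... | yes x∈p = x∈p
... | no  x∉p = contradiction ∣q∣≤∣p∣ (<⇒≱ (p⊂q⇒∣p∣<∣q∣ (p⊆q , x , x∈q , x∉p)))

x∈p⇒0<∣p∣ : {p : Subset n} {x : Fin n} → x ∈ p → 0 < ∣ p ∣
x∈p⇒0<∣p∣ {p = p} {x} x∈p =
  subst (_≤ ∣ p ∣) (∣⁅x⁆∣≡1 x)
    (p⊆q⇒∣p∣≤∣q∣ λ y∈ → subst (_∈ p) (≡-sym (x∈⁅y⁆⇒x≡y x y∈)) x∈p)

x∈foldr-∪⁺ : ∀ {k} (A : Subset n) (P : Vector (Subset n) k) {x} →
             x ∈ A ⊎ (∃[ i ] x ∈ P i) → x ∈ foldr _∪_ A P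
x∈foldr-∪⁺ {k = zero}  A P (inj₁ x∈A) = x∈A
x∈foldr-∪⁺ {k = suc k} A P (inj₁ x∈A) =
  q⊆p∪q (P zero) _ (x∈foldr-∪⁺ A (P ∘ suc) (inj₁ x∈A))
x∈foldr-∪⁺ {k = suc k} A P (inj₂ (zero , x∈P)) = p⊆p∪q _ x∈P
x∈foldr-∪⁺ {k = suc k} A P (inj₂ (suc i , x∈P)) =
  q⊆p∪q (P zero) _ (x∈foldr-∪⁺ A (P ∘ suc) (inj₂ (i , x∈P)))

x∈foldr-∪⁻ : ∀ {k} (A : Subset n) (P : Vector (Subset n) k) {x} →
             x ∈ foldr _∪_ A P → x ∈ A ⊎ (∃[ i ] x ∈ P i)
x∈foldr-∪⁻ {k = zero}  A P x∈ = inj₁ x∈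
x∈foldr-∪⁻ {k = suc k} A P x∈ with x∈p∪q⁻ (P zero) _ x∈
... | inj₁ x∈P = inj₂ (zero , x∈P)
... | inj₂ x∈′ with x∈foldr-∪⁻ A (P ∘ suc) x∈′
...   | inj₁ x∈A       = inj₁ x∈A
...   | inj₂ (i , x∈P) = inj₂ (suc i , x∈P)

-- Color sets of vertex sets

x∈image⁺ : (σ : Fin n → Fin s) {W : Subset n} {v : Fin n} → v ∈ W → σ v ∈ image σ W
x∈image⁺ σ {W} {v} v∈W = lookup⇒[]= (σ v) (image σ W)
  (trans (lookup∘tabulate _ (σ v)) (dec-true (any? _) (v , v∈W , refl)))

x∈image⁻ : (σ : Fin n → Fin s) (W : Subset n) {c : Fin s} →
           c ∈ image σ W → ∃[ v ] v ∈ W × σ v ≡ c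
x∈image⁻ σ W {c} c∈ = witness (any? λ v → (v ∈? W) ×-dec (σ v ≟ c))
  (trans (≡-sym (lookup∘tabulate _ c)) ([]=⇒lookup c∈))
  where
  witness : {A : Set} (a? : Dec A) → does a? ≡ true → A
  witness (yes a) _ = a

image-mono : (σ : Fin n → Fin s) {V W : Subset n} → V ⊆ W → image σ V ⊆ image σ W
image-mono σ {V} V⊆W c∈ with x∈image⁻ σ V c∈
... | v , v∈V , refl = x∈image⁺ σ (V⊆W v∈V)

image-∪⊆ : (σ : Fin n → Fin s) (V W : Subset n) → image σ (V ∪ W) ⊆ image σ V ∪ image σ W
image-∪⊆ σ V W c∈ with x∈image⁻ σ (V ∪ W) c∈
... | v , v∈ , refl = x∈p∪q⁺ ([ inj₁ ∘ x∈image⁺ σ , inj₂ ∘ x∈image⁺ σ ]′ (x∈p∪q⁻ V W v∈))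

image-∪⊇ : (σ : Fin n → Fin s) (V W : Subset n) → image σ V ∪ image σ W ⊆ image σ (V ∪ W)
image-∪⊇ σ V W c∈ =
  [ image-mono σ (p⊆p∪q W) , image-mono σ (q⊆p∪q V W) ]′ (x∈p∪q⁻ (image σ V) _ c∈)

-- Relabeling the elements of a subset by an initial segment

-- The number of elements of the subset below the given one; on the subset `A` itself it is the
-- increasing bijection onto the numbers below `∣ A ∣`.
rank : Subset s → Fin s → ℕ
rank (_ ∷ A)       zero    = 0
rank (inside ∷ A)  (suc c) = suc (rank A c)
rank (outside ∷ A) (suc c) = rank A c

rank<∣p∣ : {A : Subset s} {c : Fin s} → c ∈ A → rank A c < ∣ A ∣
rank<∣p∣                    here       = s≤s z≤n
rank<∣p∣ {A = inside ∷ A}  (there c∈) = s≤s (rank<∣p∣ c∈)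
rank<∣p∣ {A = outside ∷ A} (there c∈) = rank<∣p∣ c∈

rank-injective : {A : Subset s} {c d : Fin s} → c ∈ A → d ∈ A → rank A c ≡ rank A d → c ≡ d
rank-injective                    here       here       eq = refl
rank-injective {A = inside ∷ A}  (there c∈) (there d∈) eq =
  cong suc (rank-injective c∈ d∈ (suc-injective eq))
rank-injective {A = outside ∷ A} (there c∈) (there d∈) eq = cong suc (rank-injective c∈ d∈ eq)

rank-surjective : (A : Subset s) {i : ℕ} → i < ∣ A ∣ → ∃[ c ] c ∈ A × rank A c ≡ i
rank-surjective (outside ∷ A) i< with rank-surjective A i<
... | c , c∈ , eq = suc c , there c∈ , eq
rank-surjective (inside ∷ A) {zero}  i< = zero , here , refl
rank-surjective (inside ∷ A) {suc i} i< with rank-surjective A (s≤s⁻¹ i<)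
... | c , c∈ , eq = suc c , there c∈ , cong suc eq

-- The remainder only makes the map total: on A it does nothing when ∣A∣ ≤ m.
relabel : (A : Subset s) (m : ℕ) .{{_ : NonZero m}} → Fin s → Fin m
relabel A m c = rank A c mod m

toℕ-relabel : (A : Subset s) .{{_ : NonZero m}} {c : Fin s} →
              ∣ A ∣ ≤ m → c ∈ A → toℕ (relabel A m c) ≡ rank A c
toℕ-relabel A ∣A∣≤m c∈ = trans (toℕ-fromℕ< _) (m<n⇒m%n≡m (<-≤-trans (rank<∣p∣ c∈) ∣A∣≤m))

-- The bound is an inequality so that color sets of different sizes can be relabeled into one common
-- palette.
relabel-injective : (A : Subset s) .{{_ : NonZero m}} {c d : Fin s} → ∣ A ∣ ≤ m →
                    c ∈ A → d ∈ A → relabel A m c ≡ relabel A m d → c ≡ d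
relabel-injective {m = m} A {c} {d} ∣A∣≤m c∈ d∈ eq = rank-injective c∈ d∈ (begin
  rank A c               ≡⟨ toℕ-relabel A ∣A∣≤m c∈ ⟨
  toℕ (relabel A m c)    ≡⟨ cong toℕ eq ⟩
  toℕ (relabel A m d)    ≡⟨ toℕ-relabel A ∣A∣≤m d∈ ⟩
  rank A d               ∎)
  where open ≡-Reasoning

relabel-surjective : (A : Subset s) .{{_ : NonZero ∣ A ∣}} (i : Fin ∣ A ∣) →
                     ∃[ c ] c ∈ A × relabel A ∣ A ∣ c ≡ i
relabel-surjective A i with rank-surjective A (toℕ<n i)
... | c , c∈ , eq = c , c∈ , toℕ-injective (trans (toℕ-relabel A ≤-refl c∈) eq)

-- Proper colorings and chromatic numbers

ProperOn : Graph n → Subset n → (Fin n → Fin s) → Set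
ProperOn G W τ = ∀ {x y} → x ∈ W → y ∈ W → Adj G x y → τ x ≢ τ y

ProperOn-⊆ : (G : Graph n) {V W : Subset n} {τ : Fin n → Fin s} →
             V ⊆ W → ProperOn G W τ → ProperOn G V τ
ProperOn-⊆ G V⊆W proper x∈ y∈ = proper (V⊆W x∈) (V⊆W y∈)

-- A `Coloring` must be surjective, so the colors that occur on `W` are renamed to an initial
-- segment. This makes any proper map comparable with the chromatic number.
normalize : (G : Graph n) {W : Subset n} {τ : Fin n → Fin s} →
            Nonempty W → ProperOn G W τ → Coloring G W ∣ image τ W ∣
normalize G {W} {τ} (_ , w∈W) properτ = record
  { color      = relabel C ∣ C ∣ ∘ τ
  ; surjective = surj
  ; proper     = λ x∈ y∈ adj eq →
      properτ x∈ y∈ adj (relabel-injective C ≤-refl (x∈image⁺ τ x∈) (x∈image⁺ τ y∈) eq)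
  }
  where
  C = image τ W
  instance
    C≢0 : NonZero ∣ C ∣
    C≢0 = >-nonZero (x∈p⇒0<∣p∣ (x∈image⁺ τ w∈W))
  surj : ∀ c → ∃[ v ] v ∈ W × relabel C ∣ C ∣ (τ v) ≡ c
  surj i with relabel-surjective C i
  ... | c , c∈ , eq with x∈image⁻ τ W c∈
  ...   | v , v∈W , refl = v , v∈W , eq

χ≤∣image∣ : (G : Graph n) {W : Subset n} {τ : Fin n → Fin s} →
            Nonempty W → IsChromaticNumber G W m → ProperOn G W τ → m ≤ ∣ image τ W ∣
χ≤∣image∣ G W≢∅ (_ , minimal) properτ = minimal _ (normalize G W≢∅ properτ)

-- Counting the image of `τ`, instead of asking for a surjective coloring, lets one and the same `τ`
-- be restricted to the parts in an induction.
UsesFewestColors : Graph n → (Fin n → Fin s) → Subset n → Set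
UsesFewestColors {n} G σ W =
  ∀ {s′} (τ : Fin n → Fin s′) → ProperOn G W τ → ∣ image σ W ∣ ≤ ∣ image τ W ∣

usesFewestColors⇒χ : (G : Graph n) {W : Subset n} {σ : Fin n → Fin s} → Nonempty W →
                     ProperOn G W σ → UsesFewestColors G σ W →
                     IsChromaticNumber G W ∣ image σ W ∣
usesFewestColors⇒χ G {W} W≢∅ properσ fewest =
  normalize G W≢∅ properσ ,
  λ j τ → ≤-trans (fewest (color τ) (proper τ)) (∣p∣≤n (image (color τ) W))

-- The pairwise content of `IsComposition`, phrased on elements so that it passes directly to unions
-- of parts.
Separated : Graph n → Label → Subset n → Subset n → Set
Separated G t A B = ∀ {x y} → x ∈ A → y ∈ B → x ≢ y × AdjacencyAcross G t x y

AdjacencyAcross-sym : (G : Graph n) (t : Label) {x y : Fin n} →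
                      AdjacencyAcross G t x y → AdjacencyAcross G t y x
AdjacencyAcross-sym G union ¬xy yx = ¬xy (Graph.sym G yx)
AdjacencyAcross-sym G join  xy     = Graph.sym G xy

-- A common color would occur at two adjacent vertices, one on each side.
join⇒disjoint-images : (G : Graph n) {V W : Subset n} {τ : Fin n → Fin s} →
                       ProperOn G (V ∪ W) τ → Separated G join V W →
                       Empty (image τ V ∩ image τ W)
join⇒disjoint-images G {V} {W} {τ} properτ sep (c , c∈)
  with c∈V , c∈W ← x∈p∩q⁻ (image τ V) (image τ W) c∈
  with v , v∈ , eq ← x∈image⁻ τ V c∈V | w , w∈ , eq′ ← x∈image⁻ τ W c∈W =
  properτ (p⊆p∪q W v∈) (q⊆p∪q V W w∈) (proj₂ (sep v∈ w∈)) (trans eq (≡-sym eq′))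

composition⇒separated : (G : Graph n) {t : Label} {W : Subset n} {k : ℕ}
                        {P : Vector (Subset n) k} → IsComposition G t W P →
                        ∀ {i j} → i ≢ j → Separated G t (P i) (P j)
composition⇒separated G comp i≢j x∈ y∈ =
  (λ { refl → IsComposition.disjoint comp i≢j (_ , x∈p∩q⁺ (x∈ , y∈)) }) ,
  IsComposition.across comp i≢j x∈ y∈

separated⇒composition : (G : Graph n) (t : Label) {A B : Subset n} → Separated G t A B →
                        IsComposition G t (A ∪ B) (A Vector.∷ B Vector.∷ Vector.[])
separated⇒composition {n} G t {A} {B} sep = record
  { cover    = λ x → mk⇔
      ([ (λ x∈A → zero , x∈A) , (λ x∈B → suc zero , x∈B) ]′ ∘ x∈p∪q⁻ A B)
      (λ { (zero , x∈A) → p⊆p∪q B x∈A ; (suc zero , x∈B) → q⊆p∪q A B x∈B })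
  ; disjoint = λ {i} {j} i≢j (x , x∈) →
      let x∈i , x∈j = x∈p∩q⁻ (P i) (P j) x∈ in proj₁ (apart i j i≢j x∈i x∈j) refl
  ; across   = λ {i} {j} i≢j x∈ y∈ → proj₂ (apart i j i≢j x∈ y∈)
  }
  where
  P : Vector (Subset n) 2
  P = A Vector.∷ B Vector.∷ Vector.[]
  apart : ∀ i j → i ≢ j → Separated G t (P i) (P j)
  apart zero       zero       i≢j = contradiction refl i≢j
  apart zero       (suc zero) _   = sep
  apart (suc zero) zero       _   x∈ y∈ =
    let y≢x , yx = sep y∈ x∈ in (λ eq → y≢x (≡-sym eq)) , AdjacencyAcross-sym G t yx
  apart (suc zero) (suc zero) i≢j = contradiction refl i≢j

-- From hc-colorings to color-minimal cographs

leaves-nonempty : (T : BinaryTree n) → Nonempty (leaves T)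
leaves-nonempty (leaf v)     = v , x∈⁅x⁆ v
leaves-nonempty (node _ l r) with leaves-nonempty l
... | v , v∈l = v , p⊆p∪q (leaves r) v∈l

usesFewestColors-⁅⁆ : (G : Graph n) (σ : Fin n → Fin s) (v : Fin n) →
                      UsesFewestColors G σ ⁅ v ⁆
usesFewestColors-⁅⁆ G σ v τ _ = begin
  ∣ image σ ⁅ v ⁆ ∣ ≤⟨ p⊆q⇒∣p∣≤∣q∣ image⊆ ⟩
  ∣ ⁅ σ v ⁆ ∣       ≡⟨ ∣⁅x⁆∣≡1 (σ v) ⟩
  1                 ≤⟨ x∈p⇒0<∣p∣ (x∈image⁺ τ (x∈⁅x⁆ v)) ⟩
  ∣ image τ ⁅ v ⁆ ∣ ∎
  where
  open ℕ.≤-Reasoning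
  image⊆ : image σ ⁅ v ⁆ ⊆ ⁅ σ v ⁆
  image⊆ c∈ with x∈image⁻ σ ⁅ v ⁆ c∈
  ... | w , w∈ , refl rewrite x∈⁅y⁆⇒x≡y v w∈ = x∈⁅x⁆ (σ v)

-- Color counts are subadditive for `σ`, and additive for a proper `τ` because its color sets on the
-- two sides are disjoint.
usesFewestColors-join : (G : Graph n) {V W : Subset n} {σ : Fin n → Fin s} →
                        Separated G join V W →
                        UsesFewestColors G σ V → UsesFewestColors G σ W →
                        UsesFewestColors G σ (V ∪ W)
usesFewestColors-join G {V} {W} {σ} sep fewestV fewestW τ properτ = begin
  ∣ image σ (V ∪ W) ∣             ≤⟨ p⊆q⇒∣p∣≤∣q∣ (image-∪⊆ σ V W) ⟩
  ∣ image σ V ∪ image σ W ∣       ≤⟨ ∣p∪q∣≤∣p∣+∣q∣ (image σ V) (image σ W) ⟩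
  ∣ image σ V ∣ + ∣ image σ W ∣   ≤⟨ +-mono-≤ (fewestV τ (ProperOn-⊆ G (p⊆p∪q W) properτ))
                                              (fewestW τ (ProperOn-⊆ G (q⊆p∪q V W) properτ)) ⟩
  ∣ image τ V ∣ + ∣ image τ W ∣   ≤⟨ disjoint⇒∣p∣+∣q∣≤∣p∪q∣ (image τ V) (image τ W)
                                       (join⇒disjoint-images G properτ sep) ⟩
  ∣ image τ V ∪ image τ W ∣       ≤⟨ p⊆q⇒∣p∣≤∣q∣ (image-∪⊇ τ V W) ⟩
  ∣ image τ (V ∪ W) ∣             ∎
  where open ℕ.≤-Reasoning

-- This serves disjoint unions: `V` is the side with all the colors, and it alone already forces `τ`
-- to use that many.
usesFewestColors-⊆ : (G : Graph n) {V W : Subset n} {σ : Fin n → Fin s} →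
                     V ⊆ W → image σ W ⊆ image σ V →
                     UsesFewestColors G σ V → UsesFewestColors G σ W
usesFewestColors-⊆ G {V} {W} {σ} V⊆W σW⊆σV fewest τ properτ = begin
  ∣ image σ W ∣ ≤⟨ p⊆q⇒∣p∣≤∣q∣ σW⊆σV ⟩
  ∣ image σ V ∣ ≤⟨ fewest τ (ProperOn-⊆ G V⊆W properτ) ⟩
  ∣ image τ V ∣ ≤⟨ p⊆q⇒∣p∣≤∣q∣ (image-mono τ V⊆W) ⟩
  ∣ image τ W ∣ ∎
  where open ℕ.≤-Reasoning

usesFewestColors-∪ : (G : Graph n) (t : Label) {V W : Subset n} {σ : Fin n → Fin s} →
                     Separated G t V W → HCCondition t (image σ V) (image σ W) →
                     UsesFewestColors G σ V → UsesFewestColors G σ W →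
                     UsesFewestColors G σ (V ∪ W)
usesFewestColors-∪ G join {σ = σ} sep _ fewestV fewestW =
  usesFewestColors-join G {σ = σ} sep fewestV fewestW
usesFewestColors-∪ G union {V} {W} {σ} _ (inj₁ σV⊆σW) _ fewestW =
  usesFewestColors-⊆ G (q⊆p∪q V W)
    (λ c∈ → [ σV⊆σW , (λ c∈W → c∈W) ]′ (x∈p∪q⁻ _ _ (image-∪⊆ σ V W c∈))) fewestW
usesFewestColors-∪ G union {V} {W} {σ} _ (inj₂ σW⊆σV) fewestV _ =
  usesFewestColors-⊆ G (p⊆p∪q W)
    (λ c∈ → [ (λ c∈V → c∈V) , σW⊆σV ]′ (x∈p∪q⁻ _ _ (image-∪⊆ σ V W c∈))) fewestV

hc⇒usesFewestColors : (G : Graph n) (σ : Fin n → Fin s) (T : BinaryTree n) →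
                      Composes G T → IsHCWithRespectTo σ T → UsesFewestColors G σ (leaves T)
hc⇒usesFewestColors G σ (leaf v) _ _ = usesFewestColors-⁅⁆ G σ v
hc⇒usesFewestColors G σ (node t l r) (comp , compl , compr) (hc , hcl , hcr) =
  usesFewestColors-∪ G t
    (composition⇒separated G comp {zero} {suc zero} λ ()) hc
    (hc⇒usesFewestColors G σ l compl hcl) (hc⇒usesFewestColors G σ r compr hcr)

-- Fewest colors are used at every subtree, so the binary cotree itself is the required recursive
-- decomposition, with two parts at each inner vertex.
hc⇒colorMinimal : (G : Graph n) (σ : Fin n → Fin s) → ProperOn G ⊤ σ →
                  (T : BinaryTree n) → Composes G T → IsHCWithRespectTo σ T →
                  IsColorMinimal G σ (leaves T)
hc⇒colorMinimal G σ properσ T comp hc = build T comp hc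
  where
  χ : ∀ T → Composes G T → IsHCWithRespectTo σ T →
      IsChromaticNumber G (leaves T) ∣ image σ (leaves T) ∣
  χ T comp hc = usesFewestColors⇒χ G (leaves-nonempty T) (ProperOn-⊆ G (λ _ → ∈⊤) properσ)
                  (hc⇒usesFewestColors G σ T comp hc)
  build : ∀ T → Composes G T → IsHCWithRespectTo σ T → IsColorMinimal G σ (leaves T)
  build T@(leaf v) comp hc = single v (χ T comp hc)
  build T@(node t l r) comp@(comp₀ , compl , compr) hc@(_ , hcl , hcr) =
    compose t _ (χ T comp hc) comp₀
      λ { zero → build l compl hcl ; (suc zero) → build r compr hcr }

-- From color-minimal cographs to hc-colorings

-- `IsHC` relativized to a vertex set, so that the induction can descend to the parts.
HasHCCotree : Graph n → (Fin n → Fin s) → Subset n → Set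
HasHCCotree G σ W = ∃[ T ] leaves T ≡ W × Composes G T × IsHCWithRespectTo σ T

hcCotree-∪ : (G : Graph n) {σ : Fin n → Fin s} (t : Label) {V W : Subset n} →
             Separated G t V W → HCCondition t (image σ V) (image σ W) →
             HasHCCotree G σ V → HasHCCotree G σ W → HasHCCotree G σ (V ∪ W)
hcCotree-∪ G t sep hc (l , refl , compl , hcl) (r , refl , compr , hcr) =
  node t l r , refl , (separated⇒composition G t sep , compl , compr) , (hc , hcl , hcr)

-- The tree is a caterpillar with `A` innermost and the `P i` attached above it one at a time. Each
-- `P i` meets a partial union containing `A`, hence the condition for all such `B`.
hcCotree-foldr :
  ∀ (G : Graph n) {σ : Fin n → Fin s} (t : Label) (A : Subset n)
  {k} (P : Vector (Subset n) k) →
  (∀ i → Separated G t (P i) A) →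
  (∀ {i j} → i ≢ j → Separated G t (P i) (P j)) →
  (∀ i {B} → A ⊆ B → Separated G t (P i) B → HCCondition t (image σ (P i)) (image σ B)) →
  HasHCCotree G σ A → (∀ i → HasHCCotree G σ (P i)) → HasHCCotree G σ (foldr _∪_ A P)
hcCotree-foldr G t A {zero}  P sepA sepP hc TA TP = TA
hcCotree-foldr G t A {suc k} P sepA sepP hc TA TP =
  hcCotree-∪ G t sep (hc zero (λ x∈A → x∈foldr-∪⁺ A (P ∘ suc) (inj₁ x∈A)) sep) (TP zero)
    (hcCotree-foldr G t A (P ∘ suc) (sepA ∘ suc) (λ i≢j → sepP (i≢j ∘ Fin.suc-injective))
      (hc ∘ suc) TA (TP ∘ suc))
  where
  sep : Separated G t (P zero) (foldr _∪_ A (P ∘ suc))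
  sep x∈ y∈ with x∈foldr-∪⁻ A (P ∘ suc) y∈
  ... | inj₁ y∈A       = sepA zero x∈ y∈A
  ... | inj₂ (i , y∈P) = sepP (λ ()) x∈ y∈P

-- `punchIn i` enumerates the indices other than `i`, so any chosen part can be made the innermost
-- one.
composition≡foldr-∪ : (G : Graph n) {t : Label} {W : Subset n} {k : ℕ}
                      {P : Vector (Subset n) (suc k)} → IsComposition G t W P →
                      ∀ i → foldr _∪_ (P i) (P ∘ punchIn i) ≡ W
composition≡foldr-∪ G {W = W} {P = P} comp i = ⊆-antisym to from
  where
  open module Cover {x} = Equivalence (IsComposition.cover comp x)
    using () renaming (to to split; from to glue)
  to : foldr _∪_ (P i) (P ∘ punchIn i) ⊆ W
  to x∈ with x∈foldr-∪⁻ (P i) (P ∘ punchIn i) x∈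
  ... | inj₁ x∈i       = glue (i , x∈i)
  ... | inj₂ (j , x∈j) = glue (punchIn i j , x∈j)
  from : W ⊆ foldr _∪_ (P i) (P ∘ punchIn i)
  from x∈W with split x∈W
  ... | j , x∈j with i ≟ j
  ...   | yes refl = x∈foldr-∪⁺ (P i) (P ∘ punchIn i) (inj₁ x∈j)
  ...   | no  i≢j  = x∈foldr-∪⁺ (P i) (P ∘ punchIn i)
    (inj₂ (punchOut i≢j , subst (λ j′ → _ ∈ P j′) (≡-sym (punchIn-punchOut i≢j)) x∈j))

-- If each ∣σ(P i)∣ were at most ℓ = ∣σ(W)∣ − 1, coloring each part with
-- relabeled colors below ℓ would contradict the minimality of ∣σ(W)∣.
union⇒part-with-all-colors :
  (G : Graph n) {σ : Fin n → Fin s} {W : Subset n} {k : ℕ} {P : Vector (Subset n) k} →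
  ProperOn G W σ → Nonempty W → IsChromaticNumber G W ∣ image σ W ∣ →
  IsComposition G union W P → ∃[ i ] image σ W ⊆ image σ (P i)
union⇒part-with-all-colors {n} G {σ} {W} {k} {P} properσ W≢∅@(w , w∈W) χ comp
  with any? (λ i → ∣ image σ W ∣ ℕ.≤? ∣ image σ (P i) ∣)
... | yes (i , ∣σW∣≤∣σPi∣) = i ,
  p⊆q∧∣q∣≤∣p∣⇒q⊆p
    (image-mono σ λ x∈ → Equivalence.from (IsComposition.cover comp _) (i , x∈)) ∣σW∣≤∣σPi∣
... | no  none = contradiction
  (≤-trans (χ≤∣image∣ G W≢∅ χ τ-proper) (∣p∣≤n (image τ W)))
  (<⇒≱ ℓ<∣σW∣)
  where
  ℓ : ℕ
  ℓ = ℕ.pred ∣ image σ W ∣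
  open module Cover {x} = Equivalence (IsComposition.cover comp x)
    using () renaming (to to split)
  ∣σP∣<∣σW∣ : ∀ i → ∣ image σ (P i) ∣ < ∣ image σ W ∣
  ∣σP∣<∣σW∣ i = ≰⇒> (λ le → none (i , le))
  ∣σP∣≤ℓ : ∀ i → ∣ image σ (P i) ∣ ≤ ℓ
  ∣σP∣≤ℓ i = ℕ.<⇒≤pred (∣σP∣<∣σW∣ i)
  instance
    σW≢0 : NonZero ∣ image σ W ∣
    σW≢0 = >-nonZero (x∈p⇒0<∣p∣ (x∈image⁺ σ w∈W))
    ℓ≢0 : NonZero ℓ
    -- The part containing `w` has at least one color and at most `ℓ`.
    ℓ≢0 = let i , w∈i = split w∈W in
      >-nonZero (<-≤-trans (x∈p⇒0<∣p∣ (x∈image⁺ σ w∈i)) (∣σP∣≤ℓ i))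
  ℓ<∣σW∣ : ℓ < ∣ image σ W ∣
  ℓ<∣σW∣ = ≤-reflexive (ℕ.suc-pred ∣ image σ W ∣)
  τ : Fin n → Fin ℓ
  τ v with any? (λ i → v ∈? P i)
  ... | yes (i , _) = relabel (image σ (P i)) ℓ (σ v)
  -- A vertex in no part lies outside `W`; its color is arbitrary.
  ... | no _        = 0 mod ℓ
  τ-proper : ProperOn G W τ
  τ-proper {x} {y} x∈W y∈W adj τx≡τy
    with any? (λ i → x ∈? P i) | any? (λ i → y ∈? P i)
  ... | no x∉       | _           = x∉ (split x∈W)
  ... | yes _       | no y∉       = y∉ (split y∈W)
  ... | yes (i , x∈i) | yes (j , y∈j) with i ≟ j
  -- Different parts of a disjoint union have no edges between them, so their independent
  -- relabelings cannot clash.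
  ...   | no i≢j   = IsComposition.across comp i≢j x∈i y∈j adj
  ...   | yes refl = properσ x∈W y∈W adj
    (relabel-injective (image σ (P i)) (∣σP∣≤ℓ i) (x∈image⁺ σ x∈i) (x∈image⁺ σ y∈j) τx≡τy)

hcCotree-compose :
  (G : Graph n) {σ : Fin n → Fin s} (t : Label) {W : Subset n} {k : ℕ}
  {P : Vector (Subset n) (suc k)} →
  ProperOn G ⊤ σ → Nonempty W → IsChromaticNumber G W ∣ image σ W ∣ →
  IsComposition G t W P → (∀ i → HasHCCotree G σ (P i)) → HasHCCotree G σ W
hcCotree-compose G {σ} t {W} {k} {P} properσ W≢∅ χ comp TP =
  subst (HasHCCotree G σ) (composition≡foldr-∪ G comp i)
    (hcCotree-foldr G t (P i) (P ∘ punchIn i)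
      (λ j → composition⇒separated G comp (punchInᵢ≢i i j))
      (λ j≢k → composition⇒separated G comp (j≢k ∘ punchIn-injective i _ _))
      hc (TP i) (TP ∘ punchIn i))
  where
  -- What the innermost part must provide: in a join any part will do, in a disjoint union it must
  -- carry every color of `W`.
  Pivot : Label → Fin (suc k) → Set
  Pivot join  i = ∀ j {B} → Separated G join (P j) B → Empty (image σ (P j) ∩ image σ B)
  Pivot union i = image σ W ⊆ image σ (P i)
  -- The label is taken as a fresh argument so that matching on it refines both `Pivot` and the
  -- composition.
  choose : ∀ t → IsComposition G t W P → ∃[ i ] Pivot t i
  choose join  comp = zero , λ j sep →
    join⇒disjoint-images G (ProperOn-⊆ G (λ _ → ∈⊤) properσ) sep
  choose union comp =
    union⇒part-with-all-colors G (ProperOn-⊆ G (λ _ → ∈⊤) properσ) W≢∅ χ comp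
  i = proj₁ (choose t comp)
  pivot⇒hc : ∀ t → IsComposition G t W P → ∀ {i} → Pivot t i → ∀ j {B} → P i ⊆ B →
             Separated G t (P j) B → HCCondition t (image σ (P j)) (image σ B)
  pivot⇒hc join  comp disjoint j Pi⊆B sep = disjoint j sep
  -- `B` contains the pivot and hence has all colors of `W`, so the attached part is always the one
  -- with the smaller color set.
  pivot⇒hc union comp σW⊆σPi  j Pi⊆B sep = inj₁ λ c∈ →
    image-mono σ Pi⊆B (σW⊆σPi
      (image-mono σ (λ x∈ → Equivalence.from (IsComposition.cover comp _) (j , x∈)) c∈))
  hc : ∀ j {B} → P i ⊆ B → Separated G t (P (punchIn i j)) B →
       HCCondition t (image σ (P (punchIn i j))) (image σ B)
  hc j = pivot⇒hc t comp (proj₂ (choose t comp)) (punchIn i j)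

colorMinimal⇒hcCotree : (G : Graph n) {σ : Fin n → Fin s} {W : Subset n} →
                        ProperOn G ⊤ σ → IsColorMinimal G σ W → HasHCCotree G σ W
colorMinimal⇒hcCotree G properσ (single v _) = leaf v , refl , tt , tt
colorMinimal⇒hcCotree G {σ} {W} properσ (compose t P χ comp minimal) =
  hcCotree-compose G t properσ W≢∅ χ comp TP
  where
  TP : ∀ i → HasHCCotree G σ (P i)
  TP i = colorMinimal⇒hcCotree G properσ (minimal i)
  -- A part already has a cotree, and every tree has a leaf.
  W≢∅ : Nonempty W
  W≢∅ with T , leaves≡P , _ ← TP zero with v , v∈T ← leaves-nonempty T =
    v , Equivalence.from (IsComposition.cover comp v) (zero , subst (v ∈_) leaves≡P v∈T)

theorem9 : ∀ {n s : ℕ} (G : Graph n) → IsCograph G ⊤ →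
    (σ : Coloring G ⊤ s) → IsRecursivelyMinimal G σ ⇔ IsHC G σ
theorem9 G _ σ = mk⇔ recMin⇒hc hc⇒recMin
  where
  recMin⇒hc : IsRecursivelyMinimal G σ → IsHC G σ
  recMin⇒hc minimal with colorMinimal⇒hcCotree G (proper σ) minimal
  ... | T , leaves≡⊤ , comp , hc = T , (leaves≡⊤ , comp) , hc
  hc⇒recMin : IsHC G σ → IsRecursivelyMinimal G σ
  hc⇒recMin (T , (leaves≡⊤ , comp) , hc) =
    subst (IsColorMinimal G (color σ)) leaves≡⊤ (hc⇒colorMinimal G (color σ) (proper σ) T comp hc)
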